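{- Let $m \ge 1$, let $\Sigma_1,\dots,\Sigma_m$ be (possibly infinite) sets, let $P \subseteq Q \subsetneq \Sigma_1 \times \cdots \times \Sigma_m$, and let $\Phi \subseteq \operatorname{Sym}(\Sigma_1) \times \cdots \times \operatorname{Sym}(\Sigma_m)$, where $\operatorname{Sym}(\Sigma)$ is the set of all permutations of $\Sigma$. Suppose that $|\Sigma_i| \ge 2$ for all $i$, that $P$ has full projections (i.e. $P|_i = \Sigma_i$ for all $i$), and that $\Phi$ is synchronous: if $\phi,\psi \in \Phi$ and $\phi_i = \psi_i$ for some $i \in [m]$, then $\phi = \psi$. Then the relation pair $(P,Q)$ is $\Phi$-box-trivial for all $n \ge 1$ if and only if it is $\Phi$-box-trivial for $n=1$ and neither of the following holds: (Unit witness obstruction) There exist $i \in [m]$ and $b \in \Sigma_i$ such that $|\Sigma_i| = 2$ and every $y \in \Sigma_1 \times \cdots \times \Sigma_m$ with $y_i = b$ belongs to $Q$. (Generalized upset obstruction) $|\Sigma_i| = 2$ for all $i$, and there exists $y \in P$ such that for all $x \in Q \setminus \{y\}$, the predicate $Q$ contains all vectors obtained from $x$ by changing an arbitrary set of coordinates to their value in the complement $\bar y$ of $y$. In particular, if all alphabets $\Sigma_i$ have size larger than $2$, then there are no obstructions (so that $(P,Q)$ is $\Phi$-box-trivial for all $n\ge 1$ if and only if it is $\Phi$-box-trivial for $n=1$).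
   Context: Here $[n] = \{1,\dots,n\}$, $\operatorname{im} f$ is the image of $f$, and $P|_i = \{x_i : x \in P\}$. If $|\Sigma_i| = 2$ and $\sigma \in \Sigma_i$, then $\bar\sigma$ denotes the other element of $\Sigma_i$; if $|\Sigma_1| = \cdots = |\Sigma_m| = 2$ and $y \in \Sigma_1 \times \cdots \times \Sigma_m$, then the complement of $y$ is $\bar y = (\bar y_1,\dots,\bar y_m)$. Thus the vectors obtained from $x$ by changing coordinates to their value in $\bar y$ are exactly the vectors $w$ with $w_i \in \{x_i,\bar y_i\}$ for all $i$. Let $P,Q \subseteq \Sigma_1 \times \cdots \times \Sigma_m$. An $n$-ary polymorphism of $(P,Q)$ is an $m$-tuple of functions $(f_1,\dots,f_m)$, where $f_i\colon \Sigma_i^n \to \Sigma_i$, such that whenever $x^{(1)},\dots,x^{(n)} \in P$, we have $(f_1(x^{(1)}_1,\dots,x^{(n)}_1), \dots, f_m(x^{(1)}_m,\dots,x^{(n)}_m)) \in Q$. Let $\Phi$ be a set of $m$-tuples $(\phi_1,\dots,\phi_m)$ of functions $\phi_i\colon \Sigma_i \to \Sigma_i$. An $m$-tuple of functions $(f_1,\dots,f_m)$, where $f_i\colon \Sigma_i^n \to \Sigma_i$, is $\Phi$-box-trivial if at least one of the following holds: (Dictator type) there exist $s \in [n]$ and $(\phi_1,\dots,\phi_m) \in \Phi$ such that $f_i(x) = \phi_i(x_s)$ for all $i \in [m]$ and all $x \in \Sigma_i^n$; (Box type) $\operatorname{im} f_1 \times \cdots \times \operatorname{im} f_m \subseteq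 Q$. The relation pair $(P,Q)$ is $\Phi$-box-trivial for $n$, where $n \ge 1$, if every $n$-ary polymorphism of $(P,Q)$ is $\Phi$-box-trivial. -}

module Defs where

open import Data.Fin.Base using (Fin; opposite)
open import Data.Nat.Base using (ℕ; _≤_)
open import Data.Product.Base using (∃; ∃-syntax; _×_; Σ-syntax)
open import Data.Sum.Base using (_⊎_)
open import Data.Vec.Functional using (Vector)
open import Function.Base using (_∘_)
open import Function.Bundles using (_↔_; _↣_; module Inverse)
open import Function.Definitions using (Bijective)
open import Level using (Level; _⊔_)
open import Relation.Binary.PropositionalEquality.Core using (_≡_; _≢_)
open import Relation.Unary using (Pred; _∈_; _⊆_; Universal)

private
  variable
    a b p q r : Level

HasSize : ℕ → Set a → Set a
HasSize k X = Fin k ↔ X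

-- No finiteness is implied: an infinite X has size at least k for every k.
SizeAtLeast : ℕ → Set a → Set a
SizeAtLeast k X = Fin k ↣ X

-- The other element of a two-element set.  The result does not depend on
-- the chosen enumeration of X.
complement : {X : Set a} → HasSize 2 X → X → X
complement e = Inverse.to e ∘ opposite ∘ Inverse.from e

im : {X : Set a} {Y : Set b} → (X → Y) → Pred Y (a ⊔ b)
im f y = ∃[ x ] f x ≡ y

module _ {m : ℕ} where

  Tuple : (Fin m → Set a) → Set a
  Tuple A = ∀ i → A i

  Operations : ℕ → (Fin m → Set a) → Set a
  Operations n A = ∀ i → Vector (A i) n → A i

  UnaryMaps : (Fin m → Set a) → Set a
  UnaryMaps A = ∀ i → A i → A i

module _ {m : ℕ} {A : Fin m → Set a} where

  -- P |ᵢ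
  projection : Pred (Tuple A) p → ∀ i → Pred (A i) (a ⊔ p)
  projection P i σ = ∃[ x ] x ∈ P × x i ≡ σ

  FullProjections : Pred (Tuple A) p → Set (a ⊔ p)
  FullProjections P = ∀ i → Universal (projection P i)

  IsPolymorphism : Pred (Tuple A) p → Pred (Tuple A) q →
                   ∀ {n} → Operations n A → Set (a ⊔ p ⊔ q)
  IsPolymorphism P Q {n} f =
    ∀ (x : Fin n → Tuple A) → (∀ j → x j ∈ P) →
    (λ i → f i (λ j → x j i)) ∈ Q

  DictatorType : Pred (UnaryMaps A) r → ∀ {n} → Operations n A → Set (a ⊔ r)
  DictatorType Φ {n} f =
    ∃[ s ] ∃[ φ ] φ ∈ Φ × (∀ i (x : Vector (A i) n) → f i x ≡ φ i (x s))

  BoxType : Pred (Tuple A) q → ∀ {n} → Operations n A → Set (a ⊔ q)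
  BoxType Q f = ∀ (y : Tuple A) → (∀ i → y i ∈ im (f i)) → y ∈ Q

  BoxTrivialFor : Pred (UnaryMaps A) r → Pred (Tuple A) p → Pred (Tuple A) q →
                  ℕ → Set (a ⊔ p ⊔ q ⊔ r)
  BoxTrivialFor Φ P Q n =
    ∀ (f : Operations n A) → IsPolymorphism P Q f → DictatorType Φ f ⊎ BoxType Q f

  BoxTrivialForAll : Pred (UnaryMaps A) r → Pred (Tuple A) p → Pred (Tuple A) q →
                     Set (a ⊔ p ⊔ q ⊔ r)
  BoxTrivialForAll Φ P Q = ∀ n → 1 ≤ n → BoxTrivialFor Φ P Q n

  -- Φ ⊆ Sym(A₁) × ⋯ × Sym(Aₘ)
  ConsistsOfPermutations : Pred (UnaryMaps A) r → Set (a ⊔ r)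
  ConsistsOfPermutations Φ = ∀ φ → φ ∈ Φ → ∀ i → Bijective _≡_ _≡_ (φ i)

  Synchronous : Pred (UnaryMaps A) r → Set (a ⊔ r)
  Synchronous Φ = ∀ φ ψ → φ ∈ Φ → ψ ∈ Φ → (∃[ i ] φ i ≡ ψ i) → φ ≡ ψ

  UnitWitnessObstruction : Pred (Tuple A) q → Set (a ⊔ q)
  UnitWitnessObstruction Q =
    ∃[ i ] Σ[ b ∈ A i ] HasSize 2 (A i) × (∀ (y : Tuple A) → y i ≡ b → y ∈ Q)

  GeneralizedUpsetObstruction : Pred (Tuple A) p → Pred (Tuple A) q → Set (a ⊔ p ⊔ q)
  GeneralizedUpsetObstruction P Q =
    Σ[ two ∈ (∀ i → HasSize 2 (A i)) ]
    ∃[ y ] y ∈ P ×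
      (∀ x → x ∈ Q → x ≢ y →
       ∀ (w : Tuple A) → (∀ i → w i ≡ x i ⊎ w i ≡ complement (two i) (y i)) → w ∈ Q)

{-# OPTIONS --safe #-}

-- Order the arguments of a polymorphism f as (x , y) with y a vector of the
-- remaining ones, and induct on the arity.  Fixing x ∈ P (respectively y ∈ Pᵏ)
-- leaves a polymorphism of smaller arity, which is a dictator or has its box
-- inside Q.  In the box case the free arguments may be replaced by arbitrary
-- functions of the fixed ones; a dictator obtained in this way cannot be
-- altered at a single point, since the altered operations would be of box type
-- and Q would contain all tuples avoiding one value β at one coordinate.
-- That is impossible: either this is a unit witness obstruction, or the values
-- other than β can be merged by a non-injective unary polymorphism.
-- If no slice of one of the two kinds is a dictator, then f is a dictator.
-- Otherwise let D be the set of x ∈ P whose slice f(x , ·) is a dictator.  If D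
-- is a singleton, then all alphabets have two elements and f is an OR up to
-- relabelling, which gives an obstruction.  If D has two elements, non-injective
-- unary polymorphisms show that Q is full, except when P = D = { y , ȳ }, a
-- generalized upset obstruction.

module Submission where

open import Defs
open import Axiom.ExcludedMiddle using (ExcludedMiddle)
open import Axiom.Extensionality.Propositional using (Extensionality)
open import Data.Bool.Base using (if_then_else_)
open import Data.Empty using (⊥)
open import Data.Fin.Base using (Fin; zero; suc; opposite; fromℕ<)
open import Data.Fin.Properties using (_≟_; 0≢1+n; injective⇒≤)
open import Data.Nat.Base using (ℕ; zero; suc; _≤_; z≤n; s≤s)
open import Data.Product.Base using (_×_; _,_; proj₁; proj₂; ∃-syntax)
open import Data.Sum.Base using (_⊎_; inj₁; inj₂; [_,_]′; map₂)
open import Data.Vec.Functional using (Vector; _∷_; [])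
open import Function.Base using (_∘_; id; const)
open import Function.Bundles
  using (_⇔_; mk⇔; mk↔ₛ′; module Equivalence; module Inverse; module Injection)
open import Function.Construct.Composition using (_↣-∘_)
open import Function.Properties.Inverse using (↔⇒↣; ↔-sym)
open import Level using (Level; _⊔_)
open import Relation.Binary.PropositionalEquality
  using (_≡_; _≢_; refl; sym; trans; cong; cong-app; subst; ≡-≟-identity)
open import Relation.Nullary.Decidable.Core using (Dec; yes; no; does; decidable-stable)
open import Relation.Nullary.Negation.Core using (¬_; contradiction)
open import Relation.Unary using (Pred; _∈_; _∉_; _⊆_; _⊂_; U)

private
  variable
    a b p q r ℓ : Level

-- Two-element sets and replacement of a single value.

opposite-≢ : (i : Fin 2) → opposite i ≢ i
opposite-≢ zero       ()
opposite-≢ (suc zero) ()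

≢⇒opposite : (i j : Fin 2) → j ≢ i → j ≡ opposite i
≢⇒opposite zero       zero       j≢i = contradiction refl j≢i
≢⇒opposite zero       (suc zero) j≢i = refl
≢⇒opposite (suc zero) zero       j≢i = refl
≢⇒opposite (suc zero) (suc zero) j≢i = contradiction refl j≢i

module _ {X : Set a} (e : HasSize 2 X) where
  open Inverse e

  complement-≢ : ∀ x → complement e x ≢ x
  complement-≢ x eq =
    opposite-≢ (from x) (trans (sym (strictlyInverseʳ _)) (cong from eq))

  ≢⇒complement : ∀ {x y} → y ≢ x → y ≡ complement e x
  ≢⇒complement {x} {y} y≢x =
    trans (sym (strictlyInverseˡ y)) (cong to (≢⇒opposite (from x) (from y)
      (y≢x ∘ Injection.injective (↔⇒↣ (↔-sym e)))))

hasSize-2 : {X : Set a} {x y : X} → x ≢ y → (∀ v → v ≡ x ⊎ v ≡ y) → HasSize 2 X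
hasSize-2 {X = X} {x} {y} x≢y cover =
  mk↔ₛ′ to (index ∘ cover) (λ v → to-index (cover v)) index-to
  where
  to : Fin 2 → X
  to zero    = x
  to (suc _) = y
  index : ∀ {v} → v ≡ x ⊎ v ≡ y → Fin 2
  index (inj₁ _) = zero
  index (inj₂ _) = suc zero
  to-index : ∀ {v} (c : v ≡ x ⊎ v ≡ y) → to (index c) ≡ v
  to-index (inj₁ eq) = sym eq
  to-index (inj₂ eq) = sym eq
  index-to : ∀ i → index (cover (to i)) ≡ i
  index-to zero with cover x
  ... | inj₁ _  = refl
  ... | inj₂ eq = contradiction eq x≢y
  index-to (suc zero) with cover y
  ... | inj₁ eq = contradiction (sym eq) x≢y
  ... | inj₂ _  = refl

¬size2∧size≥3 : {X : Set a} → HasSize 2 X → ¬ SizeAtLeast 3 X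
¬size2∧size≥3 e i with injective⇒≤ (Injection.injective (↔⇒↣ (↔-sym e) ↣-∘ i))
... | s≤s (s≤s ())

module _ {m : ℕ} {B : Fin m → Set b} where

  replace : (∀ j → B j) → ∀ i → B i → ∀ j → B j
  replace g i v j with i ≟ j
  ... | yes refl = v
  ... | no  _    = g j

  replace-at : ∀ g i v → replace g i v i ≡ v
  replace-at g i v rewrite ≡-≟-identity _≟_ {i} refl = refl

  replace-off : ∀ g i v {j} → i ≢ j → replace g i v j ≡ g j
  replace-off g i v {j} i≢j with i ≟ j
  ... | yes eq = contradiction eq i≢j
  ... | no  _  = refl

-- Classical case distinctions.

module Classical (em : ∀ {ℓ} → ExcludedMiddle ℓ) where

  byContradiction : {X : Set a} → ¬ ¬ X → X
  byContradiction = decidable-stable em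

  ¬∀⇒∃¬ : {X : Set a} {Y : X → Set b} → ¬ (∀ x → Y x) → ∃[ x ] ¬ Y x
  ¬∀⇒∃¬ ¬all = byContradiction λ ¬ex → ¬all λ x → byContradiction λ ¬y → ¬ex (x , ¬y)

  module _ {X : Set a} {Y : Set b} {y z : Y} where

    if-yes : (d : Dec X) → X → (if does d then y else z) ≡ y
    if-yes (yes _) _ = refl
    if-yes (no ¬x) x = contradiction x ¬x

    if-no : (d : Dec X) → ¬ X → (if does d then y else z) ≡ z
    if-no (yes x) ¬x = contradiction x ¬x
    if-no (no _)  _  = refl

  -- Abstract, so that case distinctions on em do not unfold it.
  abstract

    ite : (X : Set a) {Y : Set b} → Y → Y → Y
    ite X y z = if does (em {P = X}) then y else z

    ite-yes : {X : Set a} {Y : Set b} {y z : Y} → X → ite X y z ≡ y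
    ite-yes = if-yes em

    ite-no : {X : Set a} {Y : Set b} {y z : Y} → ¬ X → ite X y z ≡ z
    ite-no = if-no em

  other : {X : Set a} → SizeAtLeast 2 X → ∀ x → ∃[ y ] y ≢ x
  other e x with em {P = Injection.to e zero ≡ x}
  ... | no ≢x  = _ , ≢x
  ... | yes ≡x = _ , λ eq → 0≢1+n {i = zero} (Injection.injective e (trans ≡x (sym eq)))

-- The common setting, and binary polymorphisms attached to the obstructions.

module Setting
  (em : ∀ {ℓ} → ExcludedMiddle ℓ) (ext : ∀ {ℓ ℓ′} → Extensionality ℓ ℓ′)
  {a p q r : Level} {m : ℕ} (i₀ : Fin m) {A : Fin m → Set a}
  {P : Pred (Tuple A) p} {Q : Pred (Tuple A) q} {Φ : Pred (UnaryMaps A) r}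
  (P⊆Q : P ⊆ Q) (a∉ : Tuple A) (a∉Q : a∉ ∉ Q)
  (perms : ConsistsOfPermutations Φ) (size≥2 : ∀ i → SizeAtLeast 2 (A i))
  where

  open Classical em

  other′ : ∀ {i} (x : A i) → ∃[ y ] y ≢ x
  other′ {i} = other (size≥2 i)

  resp : ∀ {v w : Tuple A} → (∀ j → v j ≡ w j) → v ∈ Q → w ∈ Q
  resp v≗w = subst Q (ext v≗w)

  inj : ∀ {φ} → φ ∈ Φ → ∀ i {x y} → φ i x ≡ φ i y → x ≡ y
  inj φ∈Φ i = proj₁ (perms _ φ∈Φ i)

  surj : ∀ {φ} → φ ∈ Φ → ∀ i y → ∃[ x ] φ i x ≡ y
  surj φ∈Φ i y = let (x , eq) = proj₂ (perms _ φ∈Φ i) y in x , eq refl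

  module _ (f : Operations 2 A) (f-pol : IsPolymorphism P Q f)
           (idempotent : ∀ i x → f i (const x) ≡ x) where

    -- Idempotence makes every image full, so box type would put `a∉` into `Q`. It also forces `φ i`
    -- of a dictator to be the identity, and a projection separates `(x , y)` from `(y , x)`.
    symmetric-pair⇒nontrivial : ∀ {i x y} → x ≢ y →
      f i (x ∷ y ∷ []) ≡ f i (y ∷ x ∷ []) → ¬ BoxTrivialFor Φ P Q 2
    symmetric-pair⇒nontrivial {i} {x} {y} x≢y sym-xy trivial with trivial f f-pol
    ... | inj₂ box = a∉Q (box a∉ λ j → const (a∉ j) , idempotent j (a∉ j))
    ... | inj₁ (s , φ , _ , f≡φ) = x≢y (values s (f≡φ i _) (f≡φ i _))
      where
      φ≡id : ∀ v → φ i v ≡ v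
      φ≡id v = trans (sym (f≡φ i (const v))) (idempotent i v)
      values : ∀ s → f i (x ∷ y ∷ []) ≡ φ i ((x ∷ y ∷ []) s) →
                     f i (y ∷ x ∷ []) ≡ φ i ((y ∷ x ∷ []) s) → x ≡ y
      values zero e₁ e₂ =
        trans (sym (φ≡id x)) (trans (sym e₁) (trans sym-xy (trans e₂ (φ≡id y))))
      values (suc zero) e₁ e₂ =
        trans (sym (φ≡id x)) (trans (sym e₂) (trans (sym sym-xy) (trans e₁ (φ≡id y))))

  -- The polymorphism returns its first argument, except that coordinate `i` becomes `b` when the
  -- second argument has `b` there.
  unitWitness⇒nontrivial : UnitWitnessObstruction Q → ¬ BoxTrivialFor Φ P Q 2
  unitWitness⇒nontrivial (i , b , _ , Q-b) =
    symmetric-pair⇒nontrivial f f-pol f-idem b′≢b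
      (trans (at _) (trans (ite-yes refl) (sym (trans (at _) (ite-no b′≢b)))))
    where
    b′ = proj₁ (other′ b)
    b′≢b = proj₂ (other′ b)
    fᵢ : Vector (A i) 2 → A i
    fᵢ x = ite (x (suc zero) ≡ b) b (x zero)
    f : Operations 2 A
    f = replace (λ _ x → x zero) i fᵢ
    at : ∀ x → f i x ≡ fᵢ x
    at x = cong-app (replace-at {B = λ j → Vector (A j) 2 → A j} (λ _ x → x zero) i fᵢ) x
    f-idem : ∀ j x → f j (const x) ≡ x
    f-idem j x with i ≟ j
    ... | no _ = refl
    ... | yes refl with em {P = x ≡ b}
    ...   | yes eq = trans (ite-yes eq) (sym eq)
    ...   | no ≢b  = ite-no ≢b
    f-pol : IsPolymorphism P Q f
    f-pol x x∈P with em {P = x (suc zero) i ≡ b}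
    ... | yes eq = Q-b _ (trans (at _) (ite-yes eq))
    ... | no ≢b  = resp first (P⊆Q (x∈P zero))
      where
      first : ∀ j → x zero j ≡ f j (λ k → x k j)
      first j with i ≟ j
      ... | no _     = refl
      ... | yes refl = sym (ite-no ≢b)

  -- In each coordinate `f` is an OR with `ȳ i` as top element. If the second argument is `y`, the
  -- output is the first argument; otherwise it arises from the second by moving some coordinates to
  -- `ȳ`.
  generalizedUpset⇒nontrivial : GeneralizedUpsetObstruction P Q → ¬ BoxTrivialFor Φ P Q 2
  generalizedUpset⇒nontrivial (two , y , y∈P , closed) =
    symmetric-pair⇒nontrivial f f-pol f-idem (complement-≢ (two i₀) (y i₀))
      (trans (ite-yes refl) (sym (ite-no (complement-≢ (two i₀) (y i₀)))))
    where
    ȳ : Tuple A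
    ȳ i = complement (two i) (y i)
    f : Operations 2 A
    f i x = ite (x (suc zero) ≡ y i) (x zero) (ȳ i)
    f-idem : ∀ i x → f i (const x) ≡ x
    f-idem i x with em {P = x ≡ y i}
    ... | yes eq = ite-yes eq
    ... | no x≢y = trans (ite-no x≢y) (sym (≢⇒complement (two i) x≢y))
    f-pol : IsPolymorphism P Q f
    f-pol x x∈P with em {P = ∀ i → x (suc zero) i ≡ y i}
    ... | yes eq = resp (λ i → sym (ite-yes (eq i))) (P⊆Q (x∈P zero))
    ... | no ≢y  = closed (x (suc zero)) (P⊆Q (x∈P (suc zero)))
                     (≢y ∘ cong-app) _ towards-ȳ
      where
      towards-ȳ : ∀ i → f i (λ k → x k i) ≡ x (suc zero) i ⊎ f i (λ k → x k i) ≡ ȳ i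
      towards-ȳ i with em {P = x (suc zero) i ≡ y i} | em {P = x zero i ≡ y i}
      ... | no x₁≢  | _       = inj₂ (ite-no x₁≢)
      ... | yes x₁≡ | yes x₀≡ = inj₁ (trans (ite-yes x₁≡) (trans x₀≡ (sym x₁≡)))
      ... | yes x₁≡ | no x₀≢  = inj₂ (trans (ite-yes x₁≡) (≢⇒complement (two i) x₀≢))

  -- Unary polymorphisms and rigidity of dictators.

  module Converse
    (full : FullProjections P) (synchronous : Synchronous Φ)
    (trivial₁ : BoxTrivialFor Φ P Q 1)
    (¬unitWitness : ¬ UnitWitnessObstruction Q)
    (¬generalizedUpset : ¬ GeneralizedUpsetObstruction P Q)
    where

    IsUnaryPolymorphism : UnaryMaps A → Set (a ⊔ p ⊔ q)
    IsUnaryPolymorphism u = ∀ x → x ∈ P → (λ i → u i (x i)) ∈ Q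

    -- Members of `Φ` are injective in each coordinate, so a unary polymorphism merging two values
    -- must be of box type. The proof repeatedly puts tuples into `Q` by building such a map.
    nonInjective⇒box : ∀ u → IsUnaryPolymorphism u →
      ∀ {i x y} → x ≢ y → u i x ≡ u i y →
      ∀ w → (∀ j → ∃[ v ] u j v ≡ w j) → w ∈ Q
    nonInjective⇒box u u-pol {i} {x} {y} x≢y ux≡uy w w∈im
      with trivial₁ (λ j v → u j (v zero)) (λ x x∈P → u-pol (x zero) (x∈P zero))
    ... | inj₂ box = box w λ j → let (v , eq) = w∈im j in const v , eq
    ... | inj₁ (_ , φ , φ∈Φ , u≡φ) =
      contradiction
        (inj φ∈Φ i (trans (sym (u≡φ i (const x))) (trans ux≡uy (u≡φ i (const y)))))
        x≢y

    -- If A i has a third value, all values other than β can be merged.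
    Q-not-cocylinder : ∀ i β → ¬ (∀ y → y i ≢ β → y ∈ Q)
    Q-not-cocylinder i β Q-off with em {P = ∃[ γ ] γ ≢ β × γ ≢ proj₁ (other′ β)}
    ... | no ¬third = ¬unitWitness (i , β′ , hasSize-2 (β′≢β ∘ sym) cover ,
      λ y y≡β′ → Q-off y λ y≡β → β′≢β (trans (sym y≡β′) y≡β))
      where
      β′ = proj₁ (other′ β)
      β′≢β = proj₂ (other′ β)
      cover : ∀ v → v ≡ β ⊎ v ≡ β′
      cover v with em {P = v ≡ β} | em {P = v ≡ β′}
      ... | yes eq | _      = inj₁ eq
      ... | no _   | yes eq = inj₂ eq
      ... | no ≢β  | no ≢β′ = contradiction (v , ≢β , ≢β′) ¬third
    ... | yes (γ , γ≢β , γ≢β′) with em {P = a∉ i ≡ β}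
    ...   | no ≢β  = a∉Q (Q-off a∉ ≢β)
    -- Here `u` must fix `β`, so that `a∉`, whose value at `i` is `β`, lies in its box.
    ...   | yes ≡β = a∉Q (nonInjective⇒box u u-pol γ≢β′
                       (trans (at γ) (trans (ite-no γ≢β) (sym (trans (at β′) (ite-no β′≢β)))))
                       a∉ (λ j → a∉ j , fixed ≡β j))
      where
      β′ = proj₁ (other′ β)
      β′≢β = proj₂ (other′ β)
      uᵢ : A i → A i
      uᵢ x = ite (x ≡ β) β β′
      u : UnaryMaps A
      u = replace (λ _ → id) i uᵢ
      at : ∀ x → u i x ≡ uᵢ x
      at x = cong-app (replace-at {B = λ j → A j → A j} (λ _ → id) i uᵢ) x
      fixed : ∀ {x : Tuple A} → x i ≡ β → ∀ j → u j (x j) ≡ x j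
      fixed x≡β j with i ≟ j
      ... | no _     = refl
      ... | yes refl = trans (ite-yes x≡β) (sym x≡β)
      u-pol : IsUnaryPolymorphism u
      u-pol x x∈P with em {P = x i ≡ β}
      ... | yes x≡β = resp (sym ∘ fixed x≡β) (P⊆Q x∈P)
      ... | no x≢β  = Q-off _ λ eq → β′≢β (trans (sym (ite-no x≢β)) (trans (sym (at (x i))) eq))

    -- Let `φ i σ ≡ g y₀`, so `σ ≢ y₀ s`. Every `y` with `y s ≡ σ` avoids `y₀` and has `g y ≡ g y₀`.
    -- For `const σ` this gives `y₀ s′ ≡ σ`, hence `s ≢ s′`. Then entry `s′` can be varied while
    -- entry `s` stays `σ`, against injectivity of `φ′ i`.
    differs-at-point⇒¬dictator : ∀ {k} {i} {φ φ′} → φ ∈ Φ → φ′ ∈ Φ → (s s′ : Fin k) →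
      (g : Vector (A i) k → A i) (y₀ : Vector (A i) k) →
      (∀ y → y ≢ y₀ → g y ≡ φ i (y s)) → g y₀ ≢ φ i (y₀ s) →
      ¬ (∀ y → g y ≡ φ′ i (y s′))
    differs-at-point⇒¬dictator {i = i} {φ} {φ′} φ∈Φ φ′∈Φ s s′ g y₀ g≡φ g≢φ g≡φ′ =
      σ≢ (inj φ′∈Φ i (trans (φ′σ≡ (const σ) refl) (sym (trans (cong (φ′ i) (sym y₁s′)) φ′y₁≡))))
      where
      σ = proj₁ (surj φ∈Φ i (g y₀))
      φσ≡ : φ i σ ≡ g y₀
      φσ≡ = proj₂ (surj φ∈Φ i (g y₀))
      σ≢ : σ ≢ y₀ s
      σ≢ eq = g≢φ (trans (sym φσ≡) (cong (φ i) eq))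
      φ′σ≡ : ∀ y → y s ≡ σ → φ′ i (y s′) ≡ g y₀
      φ′σ≡ y ys≡σ = trans (sym (g≡φ′ y)) (trans
        (g≡φ y (λ y≡y₀ → σ≢ (trans (sym ys≡σ) (cong-app y≡y₀ s))))
        (trans (cong (φ i) ys≡σ) φσ≡))
      y₀s′≡σ : y₀ s′ ≡ σ
      y₀s′≡σ = inj φ′∈Φ i (trans (sym (g≡φ′ y₀)) (sym (φ′σ≡ (const σ) refl)))
      s≢s′ : s ≢ s′
      s≢s′ eq = σ≢ (trans (sym y₀s′≡σ) (cong y₀ (sym eq)))
      y₁ : Vector (A i) _
      y₁ = replace (const (y₀ s)) s σ
      y₁s′ : y₁ s′ ≡ y₀ s
      y₁s′ = replace-off (const (y₀ s)) s σ s≢s′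
      φ′y₁≡ : φ′ i (y₁ s′) ≡ g y₀
      φ′y₁≡ = φ′σ≡ y₁ (replace-at (const (y₀ s)) s σ)

    column : ∀ {k} → (Fin k → Tuple A) → ∀ i → Vector (A i) k
    column ys i j = ys j i

    -- The hypotheses say that the dictator, altered to `v` at `y₀` in coordinate `i`, is still a
    -- polymorphism. If `v` were a new value, this would be no dictator. As box type it would fill a
    -- cocylinder of `Q`: the alteration removes at most `φ i (y₀ s)` from the image at `i`, and the
    -- other images are full.
    dictator-rigid : ∀ {k} → BoxTrivialFor Φ P Q k → ∀ {φ} → φ ∈ Φ → (s : Fin k) →
      (∀ ys → (∀ j → ys j ∈ P) → (λ i → φ i (ys s i)) ∈ Q) →
      ∀ i (y₀ : Vector (A i) k) v →
      (∀ ys → (∀ j → ys j ∈ P) → column ys i ≡ y₀ →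
        ∀ w → w i ≡ v → (∀ j → i ≢ j → w j ≡ φ j (ys s j)) → w ∈ Q) →
      v ≡ φ i (y₀ s)
    dictator-rigid {k} trivialₖ {φ} φ∈Φ s pol i y₀ v pol′ = byContradiction contra
      where
      gᵢ : Vector (A i) k → A i
      gᵢ y = ite (y ≡ y₀) v (φ i (y s))
      g : Operations k A
      g = replace (λ j y → φ j (y s)) i gᵢ
      at : ∀ y → g i y ≡ gᵢ y
      at y = cong-app (replace-at (λ j y → φ j (y s)) i gᵢ) y
      off : ∀ {j} → i ≢ j → ∀ y → g j y ≡ φ j (y s)
      off i≢j y = cong-app (replace-off (λ j y → φ j (y s)) i gᵢ i≢j) y
      away : ∀ {z} → z ≢ y₀ → g i z ≡ φ i (z s)
      away ≢y₀ = trans (at _) (ite-no ≢y₀)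
      g-pol : IsPolymorphism P Q g
      g-pol ys ys∈P with em {P = column ys i ≡ y₀}
      ... | yes eq = pol′ ys ys∈P eq _ (trans (at _) (ite-yes eq)) λ j i≢j → off i≢j _
      ... | no ≢y₀ = resp same (pol ys ys∈P)
        where
        same : ∀ j → φ j (ys s j) ≡ g j (column ys j)
        same j with i ≟ j
        ... | no _     = refl
        ... | yes refl = sym (ite-no ≢y₀)
      contra : ¬ (v ≢ φ i (y₀ s))
      contra v≢ with trivialₖ g g-pol
      ... | inj₁ (s′ , φ′ , φ′∈Φ , g≡φ′) =
        differs-at-point⇒¬dictator φ∈Φ φ′∈Φ s s′ (g i) y₀ (λ _ → away)
          (λ eq → v≢ (trans (sym (trans (at y₀) (ite-yes refl))) eq)) (g≡φ′ i)
      ... | inj₂ box = Q-not-cocylinder i (φ i (y₀ s)) λ w wᵢ≢ → box w (inImage w wᵢ≢)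
        where
        inImage : ∀ w → w i ≢ φ i (y₀ s) → ∀ j → w j ∈ im (g j)
        inImage w wᵢ≢ j with surj φ∈Φ j (w j) | i ≟ j
        ... | x , φx≡w | no i≢j = const x , φx≡w
        ... | x , φx≡w | yes refl =
          const x , trans (ite-no λ eq → wᵢ≢ (trans (sym φx≡w) (cong (λ y → φ i (y s)) eq))) φx≡w

    -- If `z ≢ e`, then `z` equals `ē` somewhere and the map given for `z` is not injective there,
    -- so `Q` contains whatever arises from `z` by moving coordinates to `ē`. With `e ∈ P` this is a
    -- generalized upset.
    no-upset : (c e ē : Tuple A) → (∀ i → e i ≢ ē i) → (∀ i v → v ≢ e i → v ≡ ē i) →
      ¬ (∀ z → z ∈ Q → IsUnaryPolymorphism (λ i x → ite (x ≡ c i) (z i) (ē i)))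
    no-upset c e ē e≢ē ≢e⇒≡ē u-pol = contra
      where
      c̄ : Tuple A
      c̄ i = proj₁ (other′ (c i))
      c̄≢c : ∀ i → c̄ i ≢ c i
      c̄≢c i = proj₂ (other′ (c i))
      two : ∀ i → HasSize 2 (A i)
      two i = hasSize-2 (e≢ē i) cover
        where
        cover : ∀ v → v ≡ e i ⊎ v ≡ ē i
        cover v with em {P = v ≡ e i}
        ... | yes eq = inj₁ eq
        ... | no ≢e  = inj₂ (≢e⇒≡ē i v ≢e)
      closed : ∀ z → z ∈ Q → z ≢ e → ∀ w → (∀ i → w i ≡ z i ⊎ w i ≡ ē i) → w ∈ Q
      closed z z∈Q z≢e w w∈ with ¬∀⇒∃¬ (λ z≗e → z≢e (ext z≗e))
      ... | i , zᵢ≢eᵢ = nonInjective⇒box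
        (λ i x → ite (x ≡ c i) (z i) (ē i)) (u-pol z z∈Q) (c̄≢c i)
        (trans (ite-no (c̄≢c i)) (sym (trans (ite-yes refl) (≢e⇒≡ē i _ zᵢ≢eᵢ))))
        w λ j → [ (λ eq → c j , trans (ite-yes refl) (sym eq))
                , (λ eq → c̄ j , trans (ite-no (c̄≢c j)) (sym eq)) ]′ (w∈ j)
      contra : ⊥
      contra with em {P = e ∈ P}
      ... | yes e∈P = ¬generalizedUpset (two , e , e∈P , λ x x∈Q x≢e w w∈ →
        closed x x∈Q x≢e w λ i →
          map₂ (λ eq → trans eq (≢e⇒≡ē i _ (complement-≢ (two i) (e i)))) (w∈ i))
      -- Every member of `P` now differs from `e`, so setting coordinate `i₀` to `ē i₀` is a unary
      -- polymorphism, and it is constant at `i₀`.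
      ... | no e∉P = ¬unitWitness (i₀ , ē i₀ , two i₀ , Q-ē)
        where
        u : UnaryMaps A
        u = replace (λ _ → id) i₀ (const (ē i₀))
        at : ∀ x → u i₀ x ≡ ē i₀
        at x = cong-app (replace-at {B = λ j → A j → A j} (λ _ → id) i₀ (const (ē i₀))) x
        u-pol′ : IsUnaryPolymorphism u
        u-pol′ x x∈P = closed x (P⊆Q x∈P) (λ eq → e∉P (subst P eq x∈P)) _ towards-ē
          where
          towards-ē : ∀ i → u i (x i) ≡ x i ⊎ u i (x i) ≡ ē i
          towards-ē i with i₀ ≟ i
          ... | yes refl = inj₂ refl
          ... | no _     = inj₁ refl
        Q-ē : ∀ y → y i₀ ≡ ē i₀ → y ∈ Q
        Q-ē y y≡ē = nonInjective⇒box u u-pol′ (e≢ē i₀) (trans (at _) (sym (at _))) y inImage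
          where
          inImage : ∀ j → ∃[ v ] u j v ≡ y j
          inImage j with i₀ ≟ j
          ... | yes refl = ē j , sym y≡ē
          ... | no _     = y j , refl

    -- Coherent sets of tuples and the merging of their values.

    Coherent : Pred (Tuple A) ℓ → Set (a ⊔ ℓ)
    Coherent D = ∀ {x y} → x ∈ D → y ∈ D → ∀ {i} → x i ≡ y i → ∀ j → x j ≡ y j

    separated : {D : Pred (Tuple A) ℓ} → Coherent D → ∀ {x y} → x ∈ D → y ∈ D →
                ∀ {i} → x i ≢ y i → ∀ j → x j ≢ y j
    separated coherent x∈D y∈D {i} x≢y j eq = x≢y (coherent x∈D y∈D eq i)

    module _ {D : Pred (Tuple A) ℓ} (coherent : Coherent D) (ψ : UnaryMaps A)
      (ψ-inj : ∀ i {x y} → ψ i x ≡ ψ i y → x ≡ y) (ψ-surj : ∀ i y → ∃[ x ] ψ i x ≡ y)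
      (ψD⊆Q : ∀ {x} → x ∈ D → (λ i → ψ i (x i)) ∈ Q)
      (outside : ∀ {x} → x ∈ P → x ∉ D → ∀ w →
                 (∀ i → x i ∉ projection D i → w i ≡ ψ i (x i)) → w ∈ Q)
      {c c′ : Tuple A} (c∈D : c ∈ D) (c′∈D : c′ ∈ D) (c≢c′ : ∀ i → c i ≢ c′ i)
      {z : Tuple A} (z∈P : z ∈ P) (z∉D : z ∉ D)
      where

      private
        S : Fin m → Set _
        S i = z i ∉ projection D i

        S-nonempty : ∃[ i ] S i
        -- With `S` empty, `outside` would place every tuple in `Q`.
        S-nonempty = byContradiction λ none →
          a∉Q (outside z∈P z∉D a∉ λ i i∈S → contradiction (i , i∈S) none)

        i₁ = proj₁ S-nonempty

        i₁∈S : S i₁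
        i₁∈S = proj₂ S-nonempty

        in-D≢z : ∀ {x i} → x ∈ D → S i → x i ≢ z i
        in-D≢z x∈D i∈S eq = i∈S (_ , x∈D , eq)

        avoiding : ∀ x → ∃[ y ] y ∈ D × y i₁ ≢ x
        avoiding x with em {P = c i₁ ≡ x}
        ... | yes c≡x = c′ , c′∈D , λ c′≡x → c≢c′ i₁ (trans c≡x (sym c′≡x))
        ... | no c≢x  = c , c∈D , c≢x

        extend-pol : ∀ u → (∀ i {x} → x ∉ projection D i → u i x ≡ ψ i x) →
                     (∀ {x} → x ∈ D → (λ i → u i (x i)) ∈ Q) → IsUnaryPolymorphism u
        extend-pol u u≡ψ uD⊆Q x x∈P with em {P = x ∈ D}
        ... | yes x∈D = uD⊆Q x∈D
        ... | no x∉D  = outside x∈P x∉D _ λ i → u≡ψ i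

        -- The map `u` sends `x` to its image under `ψ` and every other member of `D` to a tuple
        -- agreeing with the image of `z` on `S`; both lie in `Q`. It merges `y` and `z` at `i₁`.
        -- The coordinates of `w` off `S` are built in as values of `u`, so `w` is in its box.
        between : ∀ {x} → x ∈ D → ∀ w →
                  (∀ i → S i → w i ≡ ψ i (z i) ⊎ w i ≡ ψ i (x i)) → w ∈ Q
        between {x} x∈D w w∈ =
          nonInjective⇒box u (extend-pol u (λ i → ite-no) uD⊆Q)
            (in-D≢z y∈D i₁∈S)
            (trans (u-y i₁) (trans (ite-yes i₁∈S) (sym (ite-no i₁∈S)))) w inImage
          where
          y = proj₁ (avoiding (x i₁))
          y∈D = proj₁ (proj₂ (avoiding (x i₁)))
          y≢x = separated coherent y∈D x∈D (proj₂ (proj₂ (avoiding (x i₁))))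
          u : UnaryMaps A
          u i v = ite (v ∈ projection D i)
                    (ite (v ≡ x i) (ψ i (x i)) (ite (S i) (ψ i (z i)) (w i)))
                    (ψ i v)
          u-x : ∀ i → u i (x i) ≡ ψ i (x i)
          u-x i = trans (ite-yes (x , x∈D , refl)) (ite-yes refl)
          u-D : ∀ {t} → t ∈ D → ∀ i → t i ≢ x i → u i (t i) ≡ ite (S i) (ψ i (z i)) (w i)
          u-D t∈D i t≢x = trans (ite-yes (_ , t∈D , refl)) (ite-no t≢x)
          u-y : ∀ i → u i (y i) ≡ ite (S i) (ψ i (z i)) (w i)
          u-y i = u-D y∈D i (y≢x i)
          uD⊆Q : ∀ {t} → t ∈ D → (λ i → u i (t i)) ∈ Q
          uD⊆Q {t} t∈D with em {P = t i₁ ≡ x i₁}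
          ... | yes eq = resp
                  (λ j → sym (trans (cong (u j) (coherent t∈D x∈D eq j)) (u-x j))) (ψD⊆Q x∈D)
          ... | no t≢x = outside z∈P z∉D _ λ i i∈S →
                  trans (u-D t∈D i (separated coherent t∈D x∈D t≢x i)) (ite-yes i∈S)
          inImage : ∀ i → ∃[ v ] u i v ≡ w i
          inImage i with em {P = S i}
          ... | no i∉S  = y i , trans (u-y i) (ite-no i∉S)
          ... | yes i∈S with w∈ i i∈S
          ...   | inj₁ w≡ψz = z i , trans (ite-no i∈S) (sym w≡ψz)
          ...   | inj₂ w≡ψx = x i , trans (u-x i) (sym w≡ψx)

      -- On `S`, each coordinate of the image of a member of `D` under `u` is the value of `ψ` at
      -- `z` or at that member, so `between` applies. One of `c` and `c′` avoids `α` at `i₁` and is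
      -- merged there with `z`, while the box of `u` contains `a∉`.
      ¬collapsible : ⊥
      ¬collapsible = a∉Q (nonInjective⇒box u (extend-pol u (λ i → ite-no) uD⊆Q)
          (in-D≢z y∈D i₁∈S)
          (trans (u-S (y , y∈D , refl) i₁∈S) (trans (ite-no y≢α) (sym (ite-no i₁∈S))))
          a∉ inImage)
        where
        α : Tuple A
        α i = proj₁ (ψ-surj i (a∉ i))
        ψα≡ : ∀ i → ψ i (α i) ≡ a∉ i
        ψα≡ i = proj₂ (ψ-surj i (a∉ i))
        y = proj₁ (avoiding (α i₁))
        y∈D = proj₁ (proj₂ (avoiding (α i₁)))
        y≢α = proj₂ (proj₂ (avoiding (α i₁)))
        u : UnaryMaps A
        u i v = ite (v ∈ projection D i)
                  (ite (S i) (ite (v ≡ α i) (ψ i v) (ψ i (z i))) (a∉ i))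
                  (ψ i v)
        u-S : ∀ {i v} → v ∈ projection D i → S i → u i v ≡ ite (v ≡ α i) (ψ i v) (ψ i (z i))
        u-S v∈ i∈S = trans (ite-yes v∈) (ite-yes i∈S)
        uD⊆Q : ∀ {t} → t ∈ D → (λ i → u i (t i)) ∈ Q
        uD⊆Q {t} t∈D = between t∈D _ onS
          where
          onS : ∀ i → S i → u i (t i) ≡ ψ i (z i) ⊎ u i (t i) ≡ ψ i (t i)
          onS i i∈S with em {P = t i ≡ α i}
          ... | yes eq = inj₂ (trans (u-S (t , t∈D , refl) i∈S) (ite-yes eq))
          ... | no t≢α = inj₁ (trans (u-S (t , t∈D , refl) i∈S) (ite-no t≢α))
        inImage : ∀ i → ∃[ v ] u i v ≡ a∉ i
        inImage i with em {P = S i} | em {P = α i ∈ projection D i}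
        ... | no i∉S  | _      = c i , trans (ite-yes (c , c∈D , refl)) (ite-no i∉S)
        ... | yes i∈S | yes α∈ = α i , trans (u-S α∈ i∈S) (trans (ite-yes refl) (ψα≡ i))
        ... | yes _   | no α∉  = α i , trans (ite-no α∉) (ψα≡ i)

    -- If there is a third member, `¬collapsible` applies to `P` without `c`, with the identity as
    -- `ψ` and `c` as the point outside. Otherwise `P` consists of `c` and `c′`, and `c` may be sent
    -- to any `z ∈ Q`, as `no-upset` requires.
    P-not-coherent : Coherent P → ∀ {c c′} → c ∈ P → c′ ∈ P → ¬ (∀ i → c i ≢ c′ i)
    P-not-coherent coherent {c} {c′} c∈P c′∈P c≢c′
      with em {P = ∃[ x ] x ∈ P × x i₀ ≢ c i₀ × x i₀ ≢ c′ i₀}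
    ... | yes (x , x∈P , x≢c , x≢c′) =
      ¬collapsible {D = λ y → y ∈ P × y i₀ ≢ c i₀}
        (λ (y∈P , _) (y′∈P , _) → coherent y∈P y′∈P)
        (λ _ → id) (λ _ → id) (λ _ y → y , refl) (λ (y∈P , _) → P⊆Q y∈P) outside
        (x∈P , x≢c) (c′∈P , (λ eq → c≢c′ i₀ (sym eq)))
        (separated coherent x∈P c′∈P x≢c′) c∈P (λ (_ , c≢c) → c≢c refl)
      where
      outside : ∀ {y} → y ∈ P → ¬ (y ∈ P × y i₀ ≢ c i₀) → ∀ w →
                (∀ i → y i ∉ projection (λ y → y ∈ P × y i₀ ≢ c i₀) i → w i ≡ y i) → w ∈ Q
      outside {y} y∈P y∉ w w≡y = resp (λ i → sym (w≡y i λ (t , (t∈P , t≢c) , t≡y) →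
                 y∉ (y∈P , λ y≡c → t≢c (trans (coherent t∈P y∈P t≡y i₀) y≡c)))) (P⊆Q y∈P)
    ... | no ¬third = no-upset c c c′ c≢c′ cover u-pol
      where
      cover : ∀ i v → v ≢ c i → v ≡ c′ i
      cover i v v≢c with full i v
      ... | x , x∈P , refl with em {P = x i ≡ c′ i}
      ...   | yes eq  = eq
      ...   | no x≢c′ = contradiction
              ( x , x∈P
              , separated coherent x∈P c∈P v≢c i₀ , separated coherent x∈P c′∈P x≢c′ i₀ ) ¬third
      u-pol : ∀ z → z ∈ Q → IsUnaryPolymorphism (λ i x → ite (x ≡ c i) (z i) (c′ i))
      u-pol z z∈Q x x∈P with em {P = x i₀ ≡ c i₀}
      ... | yes eq = resp (λ i → sym (ite-yes (coherent x∈P c∈P eq i))) z∈Q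
      ... | no x≢c = resp (λ i → sym (ite-no (separated coherent x∈P c∈P x≢c i))) (P⊆Q c′∈P)

    -- Slices of a polymorphism of arity `suc k`.

    module Slices {k} (trivialₖ : BoxTrivialFor Φ P Q k)
                  (f : Operations (suc k) A) (f-pol : IsPolymorphism P Q f) where

      F : ∀ i → A i → Vector (A i) k → A i
      F i x y = f i (x ∷ y)

      f≡F : ∀ i x → f i x ≡ F i (x zero) (x ∘ suc)
      f≡F i x = cong (f i) (ext λ { zero → refl ; (suc _) → refl })

      F-pol : ∀ {x} → x ∈ P → ∀ {ys} → (∀ j → ys j ∈ P) →
              (λ i → F i (x i) (column ys i)) ∈ Q
      F-pol {x} x∈P {ys} ys∈P =
        resp (λ i → f≡F i _) (f-pol (x ∷ ys) λ { zero → x∈P ; (suc j) → ys∈P j })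

      D₁ : Pred (Tuple A) _
      D₁ x = x ∈ P × DictatorType Φ (λ i → F i (x i))

      D₂ : Pred (Fin k → Tuple A) _
      D₂ ys = (∀ j → ys j ∈ P) × (∃[ ψ ] ψ ∈ Φ × (∀ i x → F i x (column ys i) ≡ ψ i x))

      box₁ : ∀ {x} → x ∈ P → x ∉ D₁ → BoxType Q (λ i → F i (x i))
      box₁ {x} x∈P x∉D₁ with trivialₖ (λ i → F i (x i)) (λ ys ys∈P → F-pol x∈P ys∈P)
      ... | inj₁ dictator = contradiction (x∈P , dictator) x∉D₁
      ... | inj₂ box      = box

      box₂ : ∀ {ys} → (∀ j → ys j ∈ P) → ys ∉ D₂ →
             ∀ w → (∀ i → ∃[ x ] F i x (column ys i) ≡ w i) → w ∈ Q
      box₂ {ys} ys∈P ys∉D₂ w w∈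
        with trivial₁ (λ i x → F i (x zero) (column ys i)) (λ x x∈P → F-pol (x∈P zero) ys∈P)
      ... | inj₁ (_ , ψ , ψ∈Φ , F≡ψ) =
        contradiction (ys∈P , ψ , ψ∈Φ , λ i x → F≡ψ i (const x)) ys∉D₂
      ... | inj₂ box = box w λ i → let (x , eq) = w∈ i in const x , eq

      -- Members of `P` with value `x` at `i` lie outside `D₁`, so their slices have box type. The
      -- box permits `y` as the free vector at `i` and the columns of `ys` elsewhere. Hence `ψ`,
      -- altered to `F i x y` at `x`, stays a polymorphism, and `dictator-rigid` applies in arity
      -- one.
      rigid₁ : ∀ {ys} → (∀ j → ys j ∈ P) → ∀ {ψ} → ψ ∈ Φ →
        (∀ i x → F i x (column ys i) ≡ ψ i x) →
        ∀ i x → x ∉ projection D₁ i → ∀ y → F i x y ≡ ψ i x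
      rigid₁ {ys} ys∈P {ψ} ψ∈Φ F≡ψ i x x∉ y = dictator-rigid trivial₁ ψ∈Φ zero
        (λ xs xs∈P → resp (λ j → F≡ψ j _) (F-pol (xs∈P zero) ys∈P))
        i (const x) (F i x y) altered
        where
        altered : ∀ xs → (∀ j → xs j ∈ P) → column xs i ≡ const x →
          ∀ w → w i ≡ F i x y → (∀ j → i ≢ j → w j ≡ ψ j (xs zero j)) → w ∈ Q
        altered xs xs∈P xs≡x w wᵢ≡ w≡ =
          box₁ (xs∈P zero) (λ xs∈D₁ → x∉ (xs zero , xs∈D₁ , xsᵢ≡x)) w inImage
          where
          xsᵢ≡x : xs zero i ≡ x
          xsᵢ≡x = cong-app xs≡x zero
          inImage : ∀ j → w j ∈ im (F j (xs zero j))
          inImage j with i ≟ j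
          ... | yes refl = y , trans (cong (λ v → F i v y) xsᵢ≡x) (sym wᵢ≡)
          ... | no i≢j   = column ys j , trans (F≡ψ j _) (sym (w≡ j i≢j))

      -- The mirror image of `rigid₁`, with the first argument free. Since `¬box⇒dictator` supplies
      -- a `c` that may lie outside `P`, the polymorphism property of the dictator is the separate
      -- assumption `pol`.
      rigid₂ : (c : Tuple A) → ∀ {φ} → φ ∈ Φ → ∀ s → (∀ i y → F i (c i) y ≡ φ i (y s)) →
        (∀ ys → (∀ j → ys j ∈ P) → (λ i → φ i (ys s i)) ∈ Q) →
        ∀ i y → (∀ ys → ys ∈ D₂ → column ys i ≢ y) → ∀ x → F i x y ≡ φ i (y s)
      rigid₂ c {φ} φ∈Φ s F≡φ pol i y y∉ x =
        dictator-rigid trivialₖ φ∈Φ s pol i y (F i x y) altered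
        where
        altered : ∀ ys → (∀ j → ys j ∈ P) → column ys i ≡ y →
          ∀ w → w i ≡ F i x y → (∀ j → i ≢ j → w j ≡ φ j (ys s j)) → w ∈ Q
        altered ys ys∈P ys≡y w wᵢ≡ w≡ = box₂ ys∈P (λ ys∈D₂ → y∉ ys ys∈D₂ ys≡y) w inImage
          where
          inImage : ∀ j → ∃[ v ] F j v (column ys j) ≡ w j
          inImage j with i ≟ j
          ... | yes refl = x , trans (cong (F i x) ys≡y) (sym wᵢ≡)
          ... | no i≢j   = c j , trans (F≡φ j _) (sym (w≡ j i≢j))

      module _ {ys} (ys∈P : ∀ j → ys j ∈ P) {ψ} (ψ∈Φ : ψ ∈ Φ)
               (F≡ψ : ∀ i x → F i x (column ys i) ≡ ψ i x) where

        -- Equal entries at `i` give equal slices there, hence equal `s` and equal `φ i`, and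
        -- synchrony extends this to all of `φ`. So the slices agree in every coordinate `j`; at
        -- `column ys j` they are values of the injective `ψ j`.
        D₁-coherent : Coherent D₁
        D₁-coherent {x} {x′} (_ , s , φ , φ∈Φ , F≡φ) (_ , s′ , φ′ , φ′∈Φ , F≡φ′) {i} xᵢ≡x′ᵢ j =
          inj ψ∈Φ j (trans (sym (F≡ψ j (x j))) (trans F≡F (F≡ψ j (x′ j))))
          where
          φ≡φ′ : ∀ y → φ i (y s) ≡ φ′ i (y s′)
          φ≡φ′ y = trans (sym (F≡φ i y)) (trans (cong (λ v → F i v y) xᵢ≡x′ᵢ) (F≡φ′ i y))
          s≡s′ : s ≡ s′
          -- Otherwise changing entry `s` alone in a constant vector alters one dictator and not the
          -- other.
          s≡s′ = byContradiction λ s≢s′ →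
            let (τ , τ≢σ) = other′ (x i)
                y = replace (const (x i)) s τ
            in τ≢σ (inj φ∈Φ i
                 (trans (cong (φ i) (sym (replace-at (const (x i)) s τ)))
                 (trans (φ≡φ′ y)
                 (trans (cong (φ′ i) (replace-off (const (x i)) s τ s≢s′))
                 (sym (φ≡φ′ (const (x i))))))))
          F≡F : F j (x j) (column ys j) ≡ F j (x′ j) (column ys j)
          F≡F = trans (F≡φ j _) (trans
            (cong (λ φ → φ j (ys s j)) (synchronous φ φ′ φ∈Φ φ′∈Φ (i , ext (φ≡φ′ ∘ const))))
            (trans (cong (λ s → φ′ j (ys s j)) s≡s′) (sym (F≡φ′ j _))))

        slice-surjective : ∀ i {x} → x ∈ projection D₁ i → ∀ v → ∃[ y ] F i x y ≡ v
        slice-surjective i (_ , (_ , s , φ , φ∈Φ , F≡φ) , refl) v =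
          let (σ , eq) = surj φ∈Φ i v in const σ , trans (F≡φ i _) eq

        -- This supplies the hypothesis `outside` of `¬collapsible`. Entries of `x` occurring in
        -- `D₁` have surjective slices; the others reach `ψ i (x i)` through `column ys i`.
        outside-D₁ : ∀ {x} → x ∈ P → x ∉ D₁ → ∀ w →
          (∀ i → x i ∉ projection D₁ i → w i ≡ ψ i (x i)) → w ∈ Q
        outside-D₁ {x} x∈P x∉D₁ w w≡ψ = box₁ x∈P x∉D₁ w inImage
          where
          inImage : ∀ i → w i ∈ im (F i (x i))
          inImage i with em {P = x i ∈ projection D₁ i}
          ... | yes x∈ = slice-surjective i x∈ (w i)
          ... | no x∉  = column ys i , trans (F≡ψ i _) (sym (w≡ψ i x∉))

        ψ-pol : ∀ {x} → x ∈ P → (λ i → ψ i (x i)) ∈ Q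
        ψ-pol x∈P = resp (λ i → F≡ψ i _) (F-pol x∈P ys∈P)

        -- Rigidity forces two-element alphabets. The map taking `c` to any `z ∈ Q` and all other
        -- entries to `ē` is a polymorphism, since for `x ∈ P` outside `D₁` the coordinates shared
        -- with `c` are unrestricted.
        D₁-not-singleton : ∀ {c} → c ∈ D₁ → ¬ (∀ {x} → x ∈ D₁ → ∀ i → x i ≡ c i)
        D₁-not-singleton {c} c∈D₁@(c∈P , s , φ , φ∈Φ , F≡φ) unique =
          no-upset c e ē e≢ē ≢e⇒≡ē u-pol
          where
          x̄ : Tuple A
          x̄ i = proj₁ (other′ (c i))
          x̄≢c : ∀ i → x̄ i ≢ c i
          x̄≢c i = proj₂ (other′ (c i))
          e ē : Tuple A
          e i = ψ i (c i)
          ē i = ψ i (x̄ i)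
          e≢ē : ∀ i → e i ≢ ē i
          e≢ē i eq = x̄≢c i (sym (inj ψ∈Φ i eq))
          ≢c⇒∉ : ∀ {i x} → x ≢ c i → x ∉ projection D₁ i
          ≢c⇒∉ {i} x≢c (t , t∈D₁ , t≡x) = x≢c (trans (sym t≡x) (unique t∈D₁ i))
          row : ∀ {i x} → x ≢ c i → ∀ y → F i x y ≡ ψ i x
          row {i} x≢c = rigid₁ ys∈P ψ∈Φ F≡ψ i _ (≢c⇒∉ x≢c)
          -- On the column y below, F i takes the value ē i in both rows c i and
          -- x̄ i, so by rigidity this column is constant.
          ≢c⇒≡x̄ : ∀ i {x} → x ≢ c i → x ≡ x̄ i
          ≢c⇒≡x̄ i {x} x≢c = inj ψ∈Φ i (trans (sym (row x≢c y)) (trans constant φy≡ē))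
            where
            y : Vector (A i) k
            y = const (proj₁ (surj φ∈Φ i (ē i)))
            φy≡ē : φ i (y s) ≡ ē i
            φy≡ē = proj₂ (surj φ∈Φ i (ē i))
            y∉D₂ : ∀ zs → zs ∈ D₂ → column zs i ≢ y
            y∉D₂ zs (_ , ψ′ , ψ′∈Φ , F≡ψ′) zs≡y = x̄≢c i (inj ψ′∈Φ i
              (trans (ψ′≡F (x̄ i)) (trans (row (x̄≢c i) y)
              (trans (sym φy≡ē) (trans (sym (F≡φ i y)) (sym (ψ′≡F (c i))))))))
              where
              ψ′≡F : ∀ v → ψ′ i v ≡ F i v y
              ψ′≡F v = trans (sym (F≡ψ′ i v)) (cong (F i v) zs≡y)
            constant : F i x y ≡ φ i (y s)
            constant = rigid₂ c φ∈Φ s F≡φ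
              (λ zs zs∈P → resp (λ j → F≡φ j _) (F-pol c∈P zs∈P)) i y y∉D₂ x
          ≢e⇒≡ē : ∀ i v → v ≢ e i → v ≡ ē i
          ≢e⇒≡ē i v v≢e with surj ψ∈Φ i v
          ... | x , refl = cong (ψ i) (≢c⇒≡x̄ i λ x≡c → v≢e (cong (ψ i) x≡c))
          u-pol : ∀ z → z ∈ Q → IsUnaryPolymorphism (λ i x → ite (x ≡ c i) (z i) (ē i))
          u-pol z z∈Q x x∈P with em {P = x ∈ D₁}
          ... | yes x∈D₁ = resp (λ i → sym (ite-yes (unique x∈D₁ i))) z∈Q
          ... | no x∉D₁  = outside-D₁ x∈P x∉D₁ _ λ i x∉ →
            trans (ite-no λ x≡c → x∉ (c , c∈D₁ , sym x≡c))
                  (cong (ψ i) (sym (≢c⇒≡x̄ i λ x≡c → x∉ (c , c∈D₁ , sym x≡c))))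

        -- Dictator slices of both kinds cannot coexist. If `D₁` has two members, either some point
        -- of `P` lies outside it and `¬collapsible` applies, or `P` inherits its coherence.
        D₁-empty : ∀ {c} → c ∉ D₁
        D₁-empty {c} c∈D₁@(c∈P , _) with em {P = ∃[ c′ ] c′ ∈ D₁ × c′ i₀ ≢ c i₀}
        ... | no ¬second = D₁-not-singleton c∈D₁ λ x∈D₁ →
          D₁-coherent x∈D₁ c∈D₁ (byContradiction λ x≢c → ¬second (_ , x∈D₁ , x≢c))
        ... | yes (c′ , c′∈D₁ , c′≢c) with em {P = ∃[ z ] z ∈ P × z ∉ D₁}
        ...   | yes (z , z∈P , z∉D₁) =
          ¬collapsible D₁-coherent ψ (inj ψ∈Φ) (surj ψ∈Φ) (λ (x∈P , _) → ψ-pol x∈P) outside-D₁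
            c′∈D₁ c∈D₁ (separated D₁-coherent c′∈D₁ c∈D₁ c′≢c) z∈P z∉D₁
        ...   | no ¬outside =
          P-not-coherent (λ x∈P y∈P → D₁-coherent (P⊆D₁ x∈P) (P⊆D₁ y∈P)) (proj₁ c′∈D₁) c∈P
            (separated D₁-coherent c′∈D₁ c∈D₁ c′≢c)
          where
          P⊆D₁ : ∀ {x} → x ∈ P → x ∈ D₁
          P⊆D₁ x∈P = byContradiction λ x∉D₁ → ¬outside (_ , x∈P , x∉D₁)

      ¬box⇒dictator : ∀ w → (∀ i → w i ∈ im (f i)) → w ∉ Q → DictatorType Φ f
      ¬box⇒dictator w w∈im w∉Q with em {P = ∃[ ys ] ys ∈ D₂}
      ... | yes (ys , ys∈P , ψ , ψ∈Φ , F≡ψ) = zero , ψ , ψ∈Φ , λ i x →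
        trans (f≡F i x) (rigid₁ ys∈P ψ∈Φ F≡ψ i (x zero)
          (λ (c , c∈D₁ , _) → D₁-empty ys∈P ψ∈Φ F≡ψ c∈D₁) (x ∘ suc))
      -- First arguments may now be chosen freely, so those of a preimage of `w` are frozen. The box
      -- of the resulting `k`-ary polymorphism contains `w`, so it is a dictator, and `rigid₂` with
      -- no excluded column extends it to all first arguments.
      ... | no D₂-empty with trivialₖ (λ i → F i (proj₁ (w∈im i) zero)) c-pol
        where
        c-pol : IsPolymorphism P Q (λ i → F i (proj₁ (w∈im i) zero))
        c-pol ys ys∈P = box₂ ys∈P (λ ys∈D₂ → D₂-empty (ys , ys∈D₂)) _ λ i → _ , refl
      ...   | inj₂ box = contradiction
        (box w λ i → proj₁ (w∈im i) ∘ suc , trans (sym (f≡F i _)) (proj₂ (w∈im i))) w∉Q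
      ...   | inj₁ (s , φ , φ∈Φ , F≡φ) = suc s , φ , φ∈Φ , λ i x →
        trans (f≡F i x) (rigid₂ (λ i → proj₁ (w∈im i) zero) φ∈Φ s F≡φ φ-pol i (x ∘ suc)
          (λ ys ys∈D₂ _ → D₂-empty (ys , ys∈D₂)) (x zero))
        where
        φ-pol : ∀ ys → (∀ j → ys j ∈ P) → (λ i → φ i (ys s i)) ∈ Q
        φ-pol ys ys∈P = box₂ ys∈P (λ ys∈D₂ → D₂-empty (ys , ys∈D₂)) _
          λ i → proj₁ (w∈im i) zero , F≡φ i _

    -- Induction on the arity.

    trivial-suc : ∀ {k} → BoxTrivialFor Φ P Q k → BoxTrivialFor Φ P Q (suc k)
    trivial-suc trivialₖ f f-pol with em {P = BoxType Q f}
    ... | yes box = inj₂ box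
    ... | no ¬box with ¬∀⇒∃¬ ¬box
    -- The negated implication is read as a negated universal statement over proofs of its premise,
    -- so both `w∈im` and `w∉Q` are obtained.
    ...   | w , ¬w with ¬∀⇒∃¬ ¬w
    ...     | w∈im , w∉Q = inj₁ (Slices.¬box⇒dictator trivialₖ f f-pol w w∈im w∉Q)

    trivial : BoxTrivialForAll Φ P Q
    trivial (suc zero)    _ = trivial₁
    trivial (suc (suc n)) _ = trivial-suc (trivial (suc n) (s≤s z≤n))

-- The equivalence, and alphabets with at least three elements.

theorem1p4 : (∀ {ℓ} → ExcludedMiddle ℓ) →
    (∀ {ℓ ℓ′} → Extensionality ℓ ℓ′) →
    ∀ {a p q r : Level} (m : ℕ) → 1 ≤ m →
    (A : Fin m → Set a)
    (P : Pred (Tuple A) p) (Q : Pred (Tuple A) q) (Φ : Pred (UnaryMaps A) r) →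
    P ⊆ Q → Q ⊂ U →
    ConsistsOfPermutations Φ →
    (∀ i → SizeAtLeast 2 (A i)) →
    FullProjections P →
    Synchronous Φ →
    (BoxTrivialForAll Φ P Q ⇔
    (BoxTrivialFor Φ P Q 1 ×
    ¬ UnitWitnessObstruction Q ×
    ¬ GeneralizedUpsetObstruction P Q))
    ×
    ((∀ i → SizeAtLeast 3 (A i)) →
    ¬ UnitWitnessObstruction Q ×
    ¬ GeneralizedUpsetObstruction P Q ×
    (BoxTrivialForAll Φ P Q ⇔ BoxTrivialFor Φ P Q 1))
theorem1p4 em ext m 1≤m A P Q Φ P⊆Q (_ , U⊈Q) perms size≥2 full synchronous =
  equivalence , λ size≥3 →
    ¬unit size≥3 , ¬upset size≥3 ,
    mk⇔ (λ all → all 1 (s≤s z≤n))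
        (λ trivial₁ → Equivalence.from equivalence (trivial₁ , ¬unit size≥3 , ¬upset size≥3))
  where
  i₀ : Fin m
  i₀ = fromℕ< 1≤m
  missing : ∃[ w ] w ∉ Q
  missing = Classical.¬∀⇒∃¬ em λ all → U⊈Q λ {w} _ → all w
  open Setting em ext i₀ {P = P} {Q} {Φ} P⊆Q (proj₁ missing) (proj₂ missing) perms size≥2
  equivalence : BoxTrivialForAll Φ P Q ⇔
    (BoxTrivialFor Φ P Q 1 × ¬ UnitWitnessObstruction Q × ¬ GeneralizedUpsetObstruction P Q)
  equivalence = mk⇔
    (λ all → all 1 (s≤s z≤n) ,
      (λ unit → unitWitness⇒nontrivial unit (all 2 (s≤s z≤n))) ,
      (λ upset → generalizedUpset⇒nontrivial upset (all 2 (s≤s z≤n))))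
    (λ (trivial₁ , ¬unit , ¬upset) → Converse.trivial full synchronous trivial₁ ¬unit ¬upset)
  module _ (size≥3 : ∀ i → SizeAtLeast 3 (A i)) where
    ¬unit : ¬ UnitWitnessObstruction Q
    ¬unit (i , _ , two , _) = ¬size2∧size≥3 two (size≥3 i)
    ¬upset : ¬ GeneralizedUpsetObstruction P Q
    ¬upset (two , _) = ¬size2∧size≥3 (two i₀) (size≥3 i₀)
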